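{- Let $\{a_n\}_{n\ge 0}$ be a sequence of positive real numbers and let $N_0$ be a positive integer. (1) Suppose that $a_n^2-a_{n-1}a_{n+1}>0$ for all $n\ge N_0+1$ (strict log-concavity of $\{a_n\}_{n\ge N_0}$), and that $$\left(\frac{a_n}{a_{n-1}}\right)^2<\frac{a_{n-1}}{a_{n-2}}\cdot\frac{a_{n+1}}{a_n}\quad\text{for all } n\ge N_0+2$$ (strict ratio-log-convexity of $\{a_n\}_{n\ge N_0}$). Then for all $n\ge N_0+1$, $$a_n^2(a_n^2-a_{n-1}a_{n+1})>a_{n-1}^2(a_{n+1}^2-a_na_{n+2}).$$ (2) Suppose instead that $\{a_n\}_{n\ge N_0}$ is strictly $2$-log-convex, i.e. setting $b_n=a_{n-1}a_{n+1}-a_n^2$, we have $b_n>0$ for all $n\ge N_0+1$ and $b_n^2<b_{n-1}b_{n+1}$ for all $n\ge N_0+2$, and that the strict ratio-log-convexity condition of part (1) holds. Then the same inequality $a_n^2(a_n^2-a_{n-1}a_{n+1})>a_{n-1}^2(a_{n+1}^2-a_na_{n+2})$ holds for all $n\ge N_0+2$. -}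

module Defs where

open import Data.Nat as ℕ using (ℕ)
import Data.Nat.Properties as ℕP
open import Data.Product using (∃; _×_; _,_; proj₁; proj₂)
open import Data.Rational as ℚ using (ℚ; 0ℚ; 1ℚ; ½; ∣_∣; 1/_; Positive; positive; nonNegative; NonZero)
import Data.Rational.Properties as ℚP
open import Data.Rational.Solver using (module +-*-Solver)
open import Relation.Binary.PropositionalEquality using (_≡_; refl; sym; trans; cong; cong₂; subst; module ≡-Reasoning)

open +-*-Solver using (solve; _:+_; _:*_; :-_; _:-_; _:=_)

------------------------------------------------------------------------
-- Real numbers, as Cauchy sequences of rationals.  Equality of reals is
-- the relation _≈_ below, not _≡_.

Cauchy : (ℕ → ℚ) → Set
Cauchy s = ∀ ε → 0ℚ ℚ.< ε → ∃ λ N → ∀ m n → N ℕ.≤ m → N ℕ.≤ n → ∣ s m ℚ.- s n ∣ ℚ.< ε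

record ℝ : Set where
  constructor mkℝ
  field
    seq    : ℕ → ℚ
    cauchy : Cauchy seq

open ℝ public

infix 4 _≈_ _<_ _>_

_≈_ : ℝ → ℝ → Set
x ≈ y = ∀ ε → 0ℚ ℚ.< ε → ∃ λ N → ∀ n → N ℕ.≤ n → ∣ seq x n ℚ.- seq y n ∣ ℚ.< ε

-- The gap keeps the limits apart: termwise strict inequality alone would
-- not be preserved in the limit.
record _<_ (x y : ℝ) : Set where
  constructor mk<
  field
    gap    : ℚ
    0<gap  : 0ℚ ℚ.< gap
    start  : ℕ
    bound  : ∀ n → start ℕ.≤ n → seq x n ℚ.+ gap ℚ.≤ seq y n

_>_ : ℝ → ℝ → Set
x > y = y < x

private
  half+half : ∀ p → ½ ℚ.* p ℚ.+ ½ ℚ.* p ≡ p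
  half+half p = trans (sym (ℚP.*-distribʳ-+ p ½ ½)) (ℚP.*-identityˡ p)

  0<½* : ∀ {p} → 0ℚ ℚ.< p → 0ℚ ℚ.< ½ ℚ.* p
  0<½* {p} 0<p = ℚP.positive⁻¹ (½ ℚ.* p) {{ℚP.pos*pos⇒pos ½ p {{positive 0<p}}}}

  0<* : ∀ {p q} → 0ℚ ℚ.< p → 0ℚ ℚ.< q → 0ℚ ℚ.< p ℚ.* q
  0<* {p} {q} 0<p 0<q = ℚP.positive⁻¹ (p ℚ.* q) {{ℚP.pos*pos⇒pos p {{positive 0<p}} q {{positive 0<q}}}}

  ≤-⊔ˡ : ∀ M {N n} → M ℕ.⊔ N ℕ.≤ n → M ℕ.≤ n
  ≤-⊔ˡ M {N} = ℕP.≤-trans (ℕP.m≤m⊔n M N)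

  ≤-⊔ʳ : ∀ M {N n} → M ℕ.⊔ N ℕ.≤ n → N ℕ.≤ n
  ≤-⊔ʳ M {N} = ℕP.≤-trans (ℕP.m≤n⊔m M N)

  eventually-bounded : ∀ x → ∃ λ B → 0ℚ ℚ.< B × ∃ λ N → ∀ n → N ℕ.≤ n → ∣ seq x n ∣ ℚ.≤ B
  eventually-bounded x with cauchy x 1ℚ (ℚP.positive⁻¹ 1ℚ)
  ... | N , close = 1ℚ ℚ.+ ∣ c ∣ , 0<B , N , λ n N≤n → bnd n N≤n
    where
    c = seq x N
    0<B : 0ℚ ℚ.< 1ℚ ℚ.+ ∣ c ∣
    0<B = ℚP.+-mono-<-≤ (ℚP.positive⁻¹ 1ℚ) (ℚP.0≤∣p∣ c)
    bnd : ∀ n → N ℕ.≤ n → ∣ seq x n ∣ ℚ.≤ 1ℚ ℚ.+ ∣ c ∣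
    bnd n N≤n = begin
      ∣ seq x n ∣                    ≡⟨ cong ∣_∣ (solve 2 (λ p q → p := (p :- q) :+ q) refl (seq x n) c) ⟩
      ∣ (seq x n ℚ.- c) ℚ.+ c ∣      ≤⟨ ℚP.∣p+q∣≤∣p∣+∣q∣ (seq x n ℚ.- c) c ⟩
      ∣ seq x n ℚ.- c ∣ ℚ.+ ∣ c ∣    ≤⟨ ℚP.+-monoˡ-≤ ∣ c ∣ (ℚP.<⇒≤ (close n N N≤n ℕP.≤-refl)) ⟩
      1ℚ ℚ.+ ∣ c ∣                   ∎
      where open ℚP.≤-Reasoning

  const-cauchy : ∀ p → Cauchy (λ _ → p)
  const-cauchy p ε 0<ε = 0 , λ _ _ _ _ → subst (ℚ._< ε) (sym (cong ∣_∣ (ℚP.+-inverseʳ p))) 0<ε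

  +-cauchy : ∀ x y → Cauchy (λ n → seq x n ℚ.+ seq y n)
  +-cauchy x y ε 0<ε with cauchy x (½ ℚ.* ε) (0<½* 0<ε) | cauchy y (½ ℚ.* ε) (0<½* 0<ε)
  ... | M , closeˣ | N , closeʸ = M ℕ.⊔ N , close
    where
    close : ∀ m n → M ℕ.⊔ N ℕ.≤ m → M ℕ.⊔ N ℕ.≤ n →
            ∣ (seq x m ℚ.+ seq y m) ℚ.- (seq x n ℚ.+ seq y n) ∣ ℚ.< ε
    close m n ≤m ≤n = begin-strict
      ∣ (xm ℚ.+ ym) ℚ.- (xn ℚ.+ yn) ∣        ≡⟨ cong ∣_∣ (solve 4 (λ a b c d → (a :+ b) :- (c :+ d) := (a :- c) :+ (b :- d)) refl xm ym xn yn) ⟩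
      ∣ (xm ℚ.- xn) ℚ.+ (ym ℚ.- yn) ∣        ≤⟨ ℚP.∣p+q∣≤∣p∣+∣q∣ (xm ℚ.- xn) (ym ℚ.- yn) ⟩
      ∣ xm ℚ.- xn ∣ ℚ.+ ∣ ym ℚ.- yn ∣        <⟨ ℚP.+-mono-< (closeˣ m n (≤-⊔ˡ M ≤m) (≤-⊔ˡ M ≤n)) (closeʸ m n (≤-⊔ʳ M ≤m) (≤-⊔ʳ M ≤n)) ⟩
      ½ ℚ.* ε ℚ.+ ½ ℚ.* ε                    ≡⟨ half+half ε ⟩
      ε                                      ∎
      where
      open ℚP.≤-Reasoning
      xm = seq x m ; xn = seq x n ; ym = seq y m ; yn = seq y n

  neg-cauchy : ∀ x → Cauchy (λ n → ℚ.- seq x n)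
  neg-cauchy x ε 0<ε with cauchy x ε 0<ε
  ... | N , close = N , λ m n ≤m ≤n → subst (ℚ._< ε) (eq (seq x m) (seq x n)) (close m n ≤m ≤n)
    where
    eq : ∀ p q → ∣ p ℚ.- q ∣ ≡ ∣ (ℚ.- p) ℚ.- (ℚ.- q) ∣
    eq p q = trans (sym (ℚP.∣-p∣≡∣p∣ (p ℚ.- q)))
      (cong ∣_∣ (solve 2 (λ a b → :- (a :- b) := (:- a) :- (:- b)) refl p q))

  split : ∀ {B C ε} → 0ℚ ℚ.< B → 0ℚ ℚ.< C → 0ℚ ℚ.< ε → ∃ λ η → 0ℚ ℚ.< η × B ℚ.* η ℚ.+ C ℚ.* η ≡ ε
  split {B} {C} {ε} 0<B 0<C 0<ε = go (B ℚ.+ C) refl (ℚP.+-mono-< 0<B 0<C)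
    where
    go : ∀ S → B ℚ.+ C ≡ S → 0ℚ ℚ.< S → ∃ λ η → 0ℚ ℚ.< η × B ℚ.* η ℚ.+ C ℚ.* η ≡ ε
    go S B+C≡S 0<S = S⁻¹ ℚ.* ε , 0<* (ℚP.positive⁻¹ S⁻¹ {{ℚP.1/pos⇒pos S {{positive 0<S}}}}) 0<ε , (begin
      B ℚ.* (S⁻¹ ℚ.* ε) ℚ.+ C ℚ.* (S⁻¹ ℚ.* ε)   ≡⟨ ℚP.*-distribʳ-+ (S⁻¹ ℚ.* ε) B C ⟨
      (B ℚ.+ C) ℚ.* (S⁻¹ ℚ.* ε)                 ≡⟨ cong (ℚ._* (S⁻¹ ℚ.* ε)) B+C≡S ⟩
      S ℚ.* (S⁻¹ ℚ.* ε)                         ≡⟨ ℚP.*-assoc S S⁻¹ ε ⟨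
      (S ℚ.* S⁻¹) ℚ.* ε                         ≡⟨ cong (ℚ._* ε) (ℚP.*-inverseʳ S {{S≢0}}) ⟩
      1ℚ ℚ.* ε                                  ≡⟨ ℚP.*-identityˡ ε ⟩
      ε                                         ∎)
      where
      open ≡-Reasoning
      S≢0 : NonZero S
      S≢0 = ℚP.pos⇒nonZero S {{positive 0<S}}
      S⁻¹ = 1/_ S {{S≢0}}

  ∣*∣< : ∀ p q {r η} → 0ℚ ℚ.< r → ∣ p ∣ ℚ.≤ r → ∣ q ∣ ℚ.< η → ∣ p ℚ.* q ∣ ℚ.< r ℚ.* η
  ∣*∣< p q {r} {η} 0<r ∣p∣≤r ∣q∣<η = begin-strict
    ∣ p ℚ.* q ∣        ≡⟨ ℚP.∣p*q∣≡∣p∣*∣q∣ p q ⟩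
    ∣ p ∣ ℚ.* ∣ q ∣    ≤⟨ ℚP.*-monoʳ-≤-nonNeg ∣ q ∣ {{ℚP.∣-∣-nonNeg q}} ∣p∣≤r ⟩
    r ℚ.* ∣ q ∣        <⟨ ℚP.*-monoʳ-<-pos r {{positive 0<r}} ∣q∣<η ⟩
    r ℚ.* η            ∎
    where open ℚP.≤-Reasoning

  *-difference : ∀ a b c d → a ℚ.* b ℚ.- c ℚ.* d ≡ a ℚ.* (b ℚ.- d) ℚ.+ d ℚ.* (a ℚ.- c)
  *-difference = solve 4 (λ a b c d → a :* b :- c :* d := a :* (b :- d) :+ d :* (a :- c)) refl

  *-cauchy : ∀ x y → Cauchy (λ n → seq x n ℚ.* seq y n)
  *-cauchy x y ε 0<ε =
    let B , 0<B , K , ∣x∣≤B = eventually-bounded x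
        C , 0<C , L , ∣y∣≤C = eventually-bounded y
        η , 0<η , Bη+Cη≡ε   = split 0<B 0<C 0<ε
        M , closeˣ          = cauchy x η 0<η
        N , closeʸ          = cauchy y η 0<η
    in (K ℕ.⊔ L) ℕ.⊔ (M ℕ.⊔ N) , λ m n ≤m ≤n →
      let K≤m = ≤-⊔ˡ K (≤-⊔ˡ (K ℕ.⊔ L) ≤m)
          L≤n = ≤-⊔ʳ K (≤-⊔ˡ (K ℕ.⊔ L) ≤n)
          M⊔N≤m = ≤-⊔ʳ (K ℕ.⊔ L) ≤m
          M⊔N≤n = ≤-⊔ʳ (K ℕ.⊔ L) ≤n
      in close (seq x m) (seq y m) (seq x n) (seq y n) 0<B 0<C Bη+Cη≡ε (∣x∣≤B m K≤m) (∣y∣≤C n L≤n)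
           (closeˣ m n (≤-⊔ˡ M M⊔N≤m) (≤-⊔ˡ M M⊔N≤n)) (closeʸ m n (≤-⊔ʳ M M⊔N≤m) (≤-⊔ʳ M M⊔N≤n))
    where
    close : ∀ xm ym xn yn {B C η} → 0ℚ ℚ.< B → 0ℚ ℚ.< C → B ℚ.* η ℚ.+ C ℚ.* η ≡ ε →
            ∣ xm ∣ ℚ.≤ B → ∣ yn ∣ ℚ.≤ C → ∣ xm ℚ.- xn ∣ ℚ.< η → ∣ ym ℚ.- yn ∣ ℚ.< η →
            ∣ xm ℚ.* ym ℚ.- xn ℚ.* yn ∣ ℚ.< ε
    close xm ym xn yn {B} {C} {η} 0<B 0<C Bη+Cη≡ε ∣xm∣≤B ∣yn∣≤C dx dy = begin-strict
      ∣ xm ℚ.* ym ℚ.- xn ℚ.* yn ∣                             ≡⟨ cong ∣_∣ (*-difference xm ym xn yn) ⟩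
      ∣ xm ℚ.* (ym ℚ.- yn) ℚ.+ yn ℚ.* (xm ℚ.- xn) ∣           ≤⟨ ℚP.∣p+q∣≤∣p∣+∣q∣ (xm ℚ.* (ym ℚ.- yn)) (yn ℚ.* (xm ℚ.- xn)) ⟩
      ∣ xm ℚ.* (ym ℚ.- yn) ∣ ℚ.+ ∣ yn ℚ.* (xm ℚ.- xn) ∣       <⟨ ℚP.+-mono-< (∣*∣< xm (ym ℚ.- yn) 0<B ∣xm∣≤B dy) (∣*∣< yn (xm ℚ.- xn) 0<C ∣yn∣≤C dx) ⟩
      B ℚ.* η ℚ.+ C ℚ.* η                                     ≡⟨ Bη+Cη≡ε ⟩
      ε                                                       ∎
      where open ℚP.≤-Reasoning

infixl 6 _+_ _-_
infixl 7 _*_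
infix  8 -_
infix  9 _²

fromℚ : ℚ → ℝ
fromℚ p = mkℝ (λ _ → p) (const-cauchy p)

0ℝ 1ℝ : ℝ
0ℝ = fromℚ 0ℚ
1ℝ = fromℚ 1ℚ

_+_ : ℝ → ℝ → ℝ
x + y = mkℝ (λ n → seq x n ℚ.+ seq y n) (+-cauchy x y)

-_ : ℝ → ℝ
- x = mkℝ (λ n → ℚ.- seq x n) (neg-cauchy x)

_-_ : ℝ → ℝ → ℝ
x - y = x + (- y)

_*_ : ℝ → ℝ → ℝ
x * y = mkℝ (λ n → seq x n ℚ.* seq y n) (*-cauchy x y)

_² : ℝ → ℝ
x ² = x * x

⊔-pos : ∀ p {δ} → 0ℚ ℚ.< δ → Positive (p ℚ.⊔ δ)
⊔-pos p {δ} 0<δ = positive (ℚP.<-≤-trans 0<δ (ℚP.p≤q⊔p p δ))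

-- If 0 < δ ≤ xₙ from some index on, then xₙ ⊔ δ is positive for every n and
-- equals xₙ from that index on.
inv-seq : (x : ℝ) → 0ℝ < x → ℕ → ℚ
inv-seq x 0<x n = 1/_ (seq x n ℚ.⊔ _<_.gap 0<x) {{ℚP.pos⇒nonZero (seq x n ℚ.⊔ _<_.gap 0<x) {{⊔-pos (seq x n) (_<_.0<gap 0<x)}}}}

inv-seq-inverse : ∀ x (0<x : 0ℝ < x) n → _<_.start 0<x ℕ.≤ n → seq x n ℚ.* inv-seq x 0<x n ≡ 1ℚ
inv-seq-inverse x 0<x n ≤n = begin
  seq x n ℚ.* inv-seq x 0<x n      ≡⟨ cong (ℚ._* inv-seq x 0<x n) (ℚP.p≥q⇒p⊔q≡p δ≤x) ⟨
  u ℚ.* inv-seq x 0<x n            ≡⟨ ℚP.*-inverseʳ u {{ℚP.pos⇒nonZero u {{⊔-pos (seq x n) (_<_.0<gap 0<x)}}}} ⟩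
  1ℚ                               ∎
  where
  open ≡-Reasoning
  u = seq x n ℚ.⊔ _<_.gap 0<x
  δ≤x : _<_.gap 0<x ℚ.≤ seq x n
  δ≤x = subst (ℚ._≤ seq x n) (ℚP.+-identityˡ _) (_<_.bound 0<x n ≤n)

private
  inv-cauchy : ∀ x (0<x : 0ℝ < x) → Cauchy (inv-seq x 0<x)
  inv-cauchy x 0<x ε 0<ε = K ℕ.⊔ M , close
    where
    δ = _<_.gap 0<x
    0<δ = _<_.0<gap 0<x
    K = _<_.start 0<x
    η = ε ℚ.* (δ ℚ.* δ)
    0<η = 0<* 0<ε (0<* 0<δ 0<δ)
    M = proj₁ (cauchy x η 0<η)
    δ≤x : ∀ n → K ℕ.≤ n → δ ℚ.≤ seq x n
    δ≤x n ≤n = subst (ℚ._≤ seq x n) (ℚP.+-identityˡ δ) (_<_.bound 0<x n ≤n)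
    diff : ∀ u v u' v' → u ℚ.* u' ≡ 1ℚ → v ℚ.* v' ≡ 1ℚ → (u' ℚ.- v') ℚ.* (u ℚ.* v) ≡ v ℚ.- u
    diff u v u' v' uu' vv' = begin
      (u' ℚ.- v') ℚ.* (u ℚ.* v)                        ≡⟨ solve 4 (λ a b c d → (c :- d) :* (a :* b) := (a :* c) :* b :- (b :* d) :* a) refl u v u' v' ⟩
      (u ℚ.* u') ℚ.* v ℚ.- (v ℚ.* v') ℚ.* u            ≡⟨ cong₂ (λ s t → s ℚ.* v ℚ.- t ℚ.* u) uu' vv' ⟩
      1ℚ ℚ.* v ℚ.- 1ℚ ℚ.* u                            ≡⟨ cong₂ ℚ._-_ (ℚP.*-identityˡ v) (ℚP.*-identityˡ u) ⟩
      v ℚ.- u                                          ∎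
      where open ≡-Reasoning
    close : ∀ m n → K ℕ.⊔ M ℕ.≤ m → K ℕ.⊔ M ℕ.≤ n → ∣ inv-seq x 0<x m ℚ.- inv-seq x 0<x n ∣ ℚ.< ε
    close m n ≤m ≤n = ℚP.*-cancelʳ-<-nonNeg (u ℚ.* v) {{nonNegative (ℚP.<⇒≤ 0<uv)}} (begin-strict
      ∣ u' ℚ.- v' ∣ ℚ.* (u ℚ.* v)          ≡⟨ cong (∣ u' ℚ.- v' ∣ ℚ.*_) (ℚP.0≤p⇒∣p∣≡p (ℚP.<⇒≤ 0<uv)) ⟨
      ∣ u' ℚ.- v' ∣ ℚ.* ∣ u ℚ.* v ∣        ≡⟨ ℚP.∣p*q∣≡∣p∣*∣q∣ (u' ℚ.- v') (u ℚ.* v) ⟨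
      ∣ (u' ℚ.- v') ℚ.* (u ℚ.* v) ∣        ≡⟨ cong ∣_∣ (diff u v u' v' (inv-seq-inverse x 0<x m K≤m) (inv-seq-inverse x 0<x n K≤n)) ⟩
      ∣ v ℚ.- u ∣                          <⟨ proj₂ (cauchy x η 0<η) n m (≤-⊔ʳ K ≤n) (≤-⊔ʳ K ≤m) ⟩
      ε ℚ.* (δ ℚ.* δ)                      ≤⟨ ℚP.*-monoˡ-≤-nonNeg ε {{nonNegative (ℚP.<⇒≤ 0<ε)}} δδ≤uv ⟩
      ε ℚ.* (u ℚ.* v)                      ∎)
      where
      open ℚP.≤-Reasoning
      K≤m = ≤-⊔ˡ K ≤m
      K≤n = ≤-⊔ˡ K ≤n
      u = seq x m ; v = seq x n ; u' = inv-seq x 0<x m ; v' = inv-seq x 0<x n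
      0<u : 0ℚ ℚ.< u
      0<u = ℚP.<-≤-trans 0<δ (δ≤x m K≤m)
      0<v : 0ℚ ℚ.< v
      0<v = ℚP.<-≤-trans 0<δ (δ≤x n K≤n)
      0<uv : 0ℚ ℚ.< u ℚ.* v
      0<uv = 0<* 0<u 0<v
      δδ≤uv : δ ℚ.* δ ℚ.≤ u ℚ.* v
      δδ≤uv = ℚP.≤-trans (ℚP.*-monoʳ-≤-nonNeg δ {{nonNegative (ℚP.<⇒≤ 0<δ)}} (δ≤x m K≤m))
                         (ℚP.*-monoˡ-≤-nonNeg u {{nonNegative (ℚP.<⇒≤ 0<u)}} (δ≤x n K≤n))

inv : (x : ℝ) → 0ℝ < x → ℝ
inv x 0<x = mkℝ (inv-seq x 0<x) (inv-cauchy x 0<x)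

inv-inverse : ∀ x (0<x : 0ℝ < x) → x * inv x 0<x ≈ 1ℝ
inv-inverse x 0<x ε 0<ε = _<_.start 0<x , λ n ≤n →
  subst (ℚ._< ε) (cong (λ p → ∣ p ℚ.- 1ℚ ∣) (sym (inv-seq-inverse x 0<x n ≤n))) 0<ε

-- Division by a positive real.
div : ℝ → (y : ℝ) → 0ℝ < y → ℝ
div x y 0<y = x * inv y 0<y

syntax div x y 0<y = x / y [ 0<y ]

------------------------------------------------------------------------
-- Sequences.  Indices are subtracted with ∸; at every n in the stated
-- ranges the subtraction is exact.

Positives : (ℕ → ℝ) → Set
Positives a = ∀ n → 0ℝ < a n

ratio : (a : ℕ → ℝ) → Positives a → ℕ → ℝ
ratio a a>0 n = a n / a (n ℕ.∸ 1) [ a>0 (n ℕ.∸ 1) ]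

StrictlyLogConcaveFrom : ℕ → (ℕ → ℝ) → Set
StrictlyLogConcaveFrom N₀ a =
  ∀ n → n ℕ.≥ N₀ ℕ.+ 1 → (a n) ² - a (n ℕ.∸ 1) * a (n ℕ.+ 1) > 0ℝ

StrictlyRatioLogConvexFrom : ℕ → (a : ℕ → ℝ) → Positives a → Set
StrictlyRatioLogConvexFrom N₀ a a>0 =
  ∀ n → n ℕ.≥ N₀ ℕ.+ 2 →
  (ratio a a>0 n) ² < ratio a a>0 (n ℕ.∸ 1) * ratio a a>0 (n ℕ.+ 1)

Strictly2LogConvexFrom : ℕ → (ℕ → ℝ) → Set
Strictly2LogConvexFrom N₀ a =
  (∀ n → n ℕ.≥ N₀ ℕ.+ 1 → b n > 0ℝ) ×
  (∀ n → n ℕ.≥ N₀ ℕ.+ 2 → (b n) ² < b (n ℕ.∸ 1) * b (n ℕ.+ 1))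
  where
  b : ℕ → ℝ
  b n = a (n ℕ.∸ 1) * a (n ℕ.+ 1) - (a n) ²

{-# OPTIONS --safe #-}
-- With x, y, z the ratios of consecutive terms p, q, r, s,
--   q²(q² − pr) − p²(r² − qs) = p²(x − y)²(q² + pr) + p³r(xz − y²),
-- and strict ratio-log-convexity says y² < xz.
-- If y² + g ≤ xz termwise and p, r are eventually at least δ, δ′, then the
-- right-hand side is eventually at least δ³δ′g.
module Submission where

open import Defs
open import Data.Nat as ℕ using (ℕ; z≤n; s≤s)
import Data.Nat.Properties as ℕP
open import Data.Product using (_×_; _,_)
open import Data.Rational as ℚ using (0ℚ; nonNegative; nonPositive; positive)
import Data.Rational.Properties as ℚP
open import Data.Rational.Solver using (module +-*-Solver)
open import Data.Sum using (inj₁; inj₂)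
open import Relation.Binary.PropositionalEquality using (_≡_; refl; trans; cong; subst; subst₂)

open +-*-Solver using (solve; _:+_; _:*_; _:-_; _:=_)

*-pos : ∀ {p q} → 0ℚ ℚ.< p → 0ℚ ℚ.< q → 0ℚ ℚ.< p ℚ.* q
*-pos {p} {q} 0<p 0<q = ℚP.positive⁻¹ (p ℚ.* q) {{ℚP.pos*pos⇒pos p {{positive 0<p}} q {{positive 0<q}}}}

*-mono-≤-pos : ∀ {p q u v} → 0ℚ ℚ.< p → 0ℚ ℚ.< u → p ℚ.≤ q → u ℚ.≤ v → p ℚ.* u ℚ.≤ q ℚ.* v
*-mono-≤-pos {p} {q} {u} 0<p 0<u p≤q u≤v =
  ℚP.≤-trans (ℚP.*-monoʳ-≤-nonNeg u {{nonNegative (ℚP.<⇒≤ 0<u)}} p≤q)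
             (ℚP.*-monoˡ-≤-nonNeg q {{nonNegative (ℚP.≤-trans (ℚP.<⇒≤ 0<p) p≤q)}} u≤v)

0≤p*p : ∀ p → 0ℚ ℚ.≤ p ℚ.* p
0≤p*p p with ℚP.≤-total 0ℚ p
... | inj₁ 0≤p = subst (ℚ._≤ p ℚ.* p) (ℚP.*-zeroʳ p) (ℚP.*-monoˡ-≤-nonNeg p {{nonNegative 0≤p}} 0≤p)
... | inj₂ p≤0 = subst (ℚ._≤ p ℚ.* p) (ℚP.*-zeroʳ p) (ℚP.*-monoˡ-≤-nonPos p {{nonPositive p≤0}} p≤0)

-- The ratios enter through products rather than quotients, so eliminating `q`, `r`, `s` leaves a
-- polynomial identity in `p`, `x`, `y`, `z`. The last summand groups `p` with `x - y` to display a
-- square.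
difference-identity : ∀ p x y z {q r s} → x ℚ.* p ≡ q → y ℚ.* q ≡ r → z ℚ.* r ≡ s →
  q ℚ.* q ℚ.* (q ℚ.* q ℚ.- p ℚ.* r)
    ≡ p ℚ.* p ℚ.* (r ℚ.* r ℚ.- q ℚ.* s)
      ℚ.+ (p ℚ.* (p ℚ.* (p ℚ.* r)) ℚ.* (x ℚ.* z ℚ.- y ℚ.* y)
        ℚ.+ (p ℚ.* (x ℚ.- y)) ℚ.* (p ℚ.* (x ℚ.- y)) ℚ.* (q ℚ.* q ℚ.+ p ℚ.* r))
difference-identity p x y z refl refl refl =
  solve 4 (λ p x y z → let q = x :* p ; r = y :* q ; s = z :* r in
    q :* q :* (q :* q :- p :* r)
      := p :* p :* (r :* r :- q :* s)
         :+ (p :* (p :* (p :* r)) :* (x :* z :- y :* y)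
           :+ (p :* (x :- y)) :* (p :* (x :- y)) :* (q :* q :+ p :* r)))
    refl p x y z

-- This is the estimate at a single index of the Cauchy sequences. The added constant involves only
-- `δ`, `δ′` and `g`, so one gap serves all late indices, as `_<_` on reals demands.
difference-gap : ∀ p x y z {q r s δ δ′ g} → 0ℚ ℚ.< δ → 0ℚ ℚ.< δ′ → 0ℚ ℚ.< g → δ ℚ.≤ p → δ′ ℚ.≤ r →
  x ℚ.* p ≡ q → y ℚ.* q ≡ r → z ℚ.* r ≡ s → y ℚ.* y ℚ.+ g ℚ.≤ x ℚ.* z →
  p ℚ.* p ℚ.* (r ℚ.* r ℚ.- q ℚ.* s) ℚ.+ δ ℚ.* (δ ℚ.* (δ ℚ.* δ′)) ℚ.* g
    ℚ.≤ q ℚ.* q ℚ.* (q ℚ.* q ℚ.- p ℚ.* r)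
difference-gap p x y z {q} {r} {s} {δ} {δ′} {g} 0<δ 0<δ′ 0<g δ≤p δ′≤r xp≡q yq≡r zr≡s yy+g≤xz = begin
  R ℚ.+ δ ℚ.* (δ ℚ.* (δ ℚ.* δ′)) ℚ.* g     ≤⟨ ℚP.+-monoʳ-≤ R δδδδ′g≤A ⟩
  R ℚ.+ A                                  ≡⟨ cong (R ℚ.+_) (ℚP.+-identityʳ A) ⟨
  -- The square term is bounded below only by 0, since `x` and `y` may coincide; the gap comes from
  -- `A` alone.
  R ℚ.+ (A ℚ.+ 0ℚ)                         ≤⟨ ℚP.+-monoʳ-≤ R (ℚP.+-monoʳ-≤ A 0≤S) ⟩
  R ℚ.+ (A ℚ.+ w ℚ.* w ℚ.* t)              ≡⟨ difference-identity p x y z xp≡q yq≡r zr≡s ⟨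
  q ℚ.* q ℚ.* (q ℚ.* q ℚ.- p ℚ.* r)        ∎
  where
  open ℚP.≤-Reasoning
  R = p ℚ.* p ℚ.* (r ℚ.* r ℚ.- q ℚ.* s)
  A = p ℚ.* (p ℚ.* (p ℚ.* r)) ℚ.* (x ℚ.* z ℚ.- y ℚ.* y)
  w = p ℚ.* (x ℚ.- y)
  t = q ℚ.* q ℚ.+ p ℚ.* r
  g≤xz-yy : g ℚ.≤ x ℚ.* z ℚ.- y ℚ.* y
  g≤xz-yy = subst (ℚ._≤ x ℚ.* z ℚ.- y ℚ.* y)
    (solve 2 (λ u v → u :+ v :- u := v) refl (y ℚ.* y) g)
    (ℚP.+-monoˡ-≤ (ℚ.- (y ℚ.* y)) yy+g≤xz)
  δδδδ′g≤A : δ ℚ.* (δ ℚ.* (δ ℚ.* δ′)) ℚ.* g ℚ.≤ A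
  δδδδ′g≤A = *-mono-≤-pos (*-pos 0<δ (*-pos 0<δ (*-pos 0<δ 0<δ′))) 0<g
    (*-mono-≤-pos 0<δ (*-pos 0<δ (*-pos 0<δ 0<δ′)) δ≤p
      (*-mono-≤-pos 0<δ (*-pos 0<δ 0<δ′) δ≤p
        (*-mono-≤-pos 0<δ 0<δ′ δ≤p δ′≤r)))
    g≤xz-yy
  0≤pr : 0ℚ ℚ.≤ p ℚ.* r
  0≤pr = ℚP.<⇒≤ (*-pos (ℚP.<-≤-trans 0<δ δ≤p) (ℚP.<-≤-trans 0<δ′ δ′≤r))
  0≤S : 0ℚ ℚ.≤ w ℚ.* w ℚ.* t
  0≤S = subst (ℚ._≤ w ℚ.* w ℚ.* t) (ℚP.*-zeroʳ (w ℚ.* w))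
    (ℚP.*-monoˡ-≤-nonNeg (w ℚ.* w) {{nonNegative (0≤p*p w)}} (ℚP.+-mono-≤ (0≤p*p q) 0≤pr))

gap≤seq : ∀ {x} (0<x : 0ℝ < x) k → _<_.start 0<x ℕ.≤ k → _<_.gap 0<x ℚ.≤ seq x k
gap≤seq {x} 0<x k ≤k = subst (ℚ._≤ seq x k) (ℚP.+-identityˡ (_<_.gap 0<x)) (_<_.bound 0<x k ≤k)

-- `inv-seq` inverts the terms exactly once the positivity bound is in force, so this is a true
-- equality of rationals, not an approximation. The equation on indices absorbs the truncated
-- subtraction inside `ratio`.
ratio-cancel : ∀ a (a>0 : Positives a) {m n} → m ℕ.∸ 1 ≡ n → ∀ k → _<_.start (a>0 n) ℕ.≤ k →
  seq (ratio a a>0 m) k ℚ.* seq (a n) k ≡ seq (a m) k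
ratio-cancel a a>0 {m} {n} refl k ≤k =
  trans (solve 3 (λ u v w → (u :* v) :* w := u :* (w :* v)) refl (seq (a m) k) (inv-seq (a n) (a>0 n) k) (seq (a n) k))
        (trans (cong (seq (a m) k ℚ.*_) (inv-seq-inverse (a n) (a>0 n) k ≤k)) (ℚP.*-identityʳ (seq (a m) k)))

ratio-log-convex⇒difference> : ∀ a (a>0 : Positives a) n →
  ratio a a>0 (n ℕ.+ 1) ² < ratio a a>0 n * ratio a a>0 (n ℕ.+ 2) →
  (a n) ² * ((a n) ² - a (n ℕ.∸ 1) * a (n ℕ.+ 1))
    > (a (n ℕ.∸ 1)) ² * ((a (n ℕ.+ 1)) ² - a n * a (n ℕ.+ 2))
ratio-log-convex⇒difference> a a>0 n y²<xz =
  mk< (δ ℚ.* (δ ℚ.* (δ ℚ.* δ′)) ℚ.* g) (*-pos (*-pos 0<δ (*-pos 0<δ (*-pos 0<δ 0<δ′))) 0<g)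
      -- Beyond `P`, `Q`, `R` the denominators of the three ratios cancel; `P` and `R` also give the
      -- lower bounds `δ`, `δ′`, and `G` gives the convexity gap.
      ((P ℕ.⊔ Q) ℕ.⊔ (R ℕ.⊔ G)) λ k ≤k →
    let PQ≤k = ℕP.m⊔n≤o⇒m≤o (P ℕ.⊔ Q) (R ℕ.⊔ G) ≤k
        RG≤k = ℕP.m⊔n≤o⇒n≤o (P ℕ.⊔ Q) (R ℕ.⊔ G) ≤k
        P≤k  = ℕP.m⊔n≤o⇒m≤o P Q PQ≤k
        Q≤k  = ℕP.m⊔n≤o⇒n≤o P Q PQ≤k
        R≤k  = ℕP.m⊔n≤o⇒m≤o R G RG≤k
        G≤k  = ℕP.m⊔n≤o⇒n≤o R G RG≤k
    in difference-gap (seq (a (n ℕ.∸ 1)) k) (seq (ratio a a>0 n) k)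
         (seq (ratio a a>0 (n ℕ.+ 1)) k) (seq (ratio a a>0 (n ℕ.+ 2)) k)
         0<δ 0<δ′ 0<g
         (gap≤seq (a>0 (n ℕ.∸ 1)) k P≤k) (gap≤seq (a>0 (n ℕ.+ 1)) k R≤k)
         -- This also covers `n = 0`, where `n ∸ 1` is 0 and the ratio is `a 0` over itself.
         (ratio-cancel a a>0 {n} refl k P≤k)
         (ratio-cancel a a>0 (ℕP.m+n∸n≡m n 1) k Q≤k)
         (ratio-cancel a a>0 (ℕP.+-∸-assoc n {2} {1} (s≤s z≤n)) k R≤k)
         (_<_.bound y²<xz k G≤k)
  where
  open _<_ (a>0 (n ℕ.∸ 1)) renaming (gap to δ; 0<gap to 0<δ; start to P) using ()
  open _<_ (a>0 n) renaming (start to Q) using ()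
  open _<_ (a>0 (n ℕ.+ 1)) renaming (gap to δ′; 0<gap to 0<δ′; start to R) using ()
  open _<_ y²<xz renaming (gap to g; 0<gap to 0<g; start to G) using ()

theorem4p1 : (a : ℕ → ℝ) (a>0 : ∀ n → a n > 0ℝ) (N₀ : ℕ) → N₀ ℕ.> 0 →
    ( StrictlyLogConcaveFrom N₀ a →
    StrictlyRatioLogConvexFrom N₀ a a>0 →
    ∀ n → n ℕ.≥ N₀ ℕ.+ 1 →
    (a n) ² * ((a n) ² - a (n ℕ.∸ 1) * a (n ℕ.+ 1))
    > (a (n ℕ.∸ 1)) ² * ((a (n ℕ.+ 1)) ² - a n * a (n ℕ.+ 2)) )
    ×
    ( Strictly2LogConvexFrom N₀ a →
    StrictlyRatioLogConvexFrom N₀ a a>0 →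
    ∀ n → n ℕ.≥ N₀ ℕ.+ 2 →
    (a n) ² * ((a n) ² - a (n ℕ.∸ 1) * a (n ℕ.+ 1))
    > (a (n ℕ.∸ 1)) ² * ((a (n ℕ.+ 1)) ² - a n * a (n ℕ.+ 2)) )
theorem4p1 a a>0 N₀ _ =
  (λ _ convex n N₀+1≤n → difference> convex n N₀+1≤n) ,
  -- The range here starts one later, so its bound is weakened to `N₀ + 1`.
  (λ _ convex n N₀+2≤n → difference> convex n (ℕP.≤-trans (ℕP.+-monoʳ-≤ N₀ (s≤s z≤n)) N₀+2≤n))
  where
  difference> : StrictlyRatioLogConvexFrom N₀ a a>0 → ∀ n → n ℕ.≥ N₀ ℕ.+ 1 →
    (a n) ² * ((a n) ² - a (n ℕ.∸ 1) * a (n ℕ.+ 1))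
      > (a (n ℕ.∸ 1)) ² * ((a (n ℕ.+ 1)) ² - a n * a (n ℕ.+ 2))
  -- Convexity is taken at `n + 1`, whose ratios span the four terms from `n ∸ 1` to `n + 2`; its
  -- threshold `N₀ + 2` is the bound on `n` shifted by one.
  difference> convex n N₀+1≤n = ratio-log-convex⇒difference> a a>0 n
    (subst₂ (λ i j → ratio a a>0 (n ℕ.+ 1) ² < ratio a a>0 i * ratio a a>0 j)
      (ℕP.m+n∸n≡m n 1) (ℕP.+-assoc n 1 1)
      (convex (n ℕ.+ 1) (subst (ℕ._≤ n ℕ.+ 1) (ℕP.+-assoc N₀ 1 1) (ℕP.+-monoˡ-≤ 1 N₀+1≤n))))
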